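{- Let $\Gamma$ be a set of formulas of $\mathcal{L}_{L'}$ and $A$ a propositional formula. If there is a closed tableau in $\mathcal{T}\mathbf{C}$ for each of the following sets of formulas: (1) $\Gamma,\neg LA$; (2) $\Gamma^{|\!\sim^{\pm}},\Gamma^{\Box^{\downarrow}},LA,\Box\neg LA$; (3) $\Gamma,\Box\neg LA$; then there is also a closed tableau in $\mathcal{T}\mathbf{C}$ for $\Gamma$. That is, the rule (Weak-Cut), with premise $\Gamma$ and conclusions (1), (2), (3), is admissible in $\mathcal{T}\mathbf{C}$.
   Context: **Language.** Propositional formulas ($A,B,\dots$) are built from a set $\mathit{ATM}$ of propositional variables with $\neg,\wedge,\vee,\rightarrow$. $\mathcal{L}$ consists of the boolean combinations of propositional formulas and conditionals $A\mathrel{|\!\sim}B$ ($A,B$ propositional). $\mathcal{L}_{L'}$ extends $\mathcal{L}$ by formulas $LA$ and $\Box\neg LA$ with $A$ propositional, where negated box formulas $\neg\Box\neg LA$ are not allowed (i.e. formulas $\Box\neg LA$ occur only positively). $F,G$ denote arbitrary formulas. **Calculus $\mathcal{T}\mathbf{C}$.** Nodes are sets of formulas; $\Gamma,F$ means $\Gamma\cup\{F\}$ (and a comma between sets denotes union). Put $\Gamma^{\Box^{\downarrow}}=\{\neg LA\mid\Box\neg LA\in\Gamma\}$, $\Gamma^{L^{\downarrow}}=\{A\mid LA\in\Gamma\}$, $\Gamma^{|\!\sim^{\pm}}=\{A\mathrel{|\!\sim}B\mid A\mathrel{|\!\sim}B\in\Gamma\}\cup\{\neg(A\mathrel{|\!\sim}B)\mid\neg(A\mathrel{|\!\sim}B)\in\Gamma\}$.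 Rules (premise $\leadsto$ conclusions, separated by $\mid$): - axiom (AX): $\Gamma,P,\neg P$ with $P\in\mathit{ATM}$; - $\Gamma,\neg\neg F\leadsto\Gamma,F$; $\ \Gamma,F\wedge G\leadsto\Gamma,F,G$; $\ \Gamma,\neg(F\wedge G)\leadsto\Gamma,\neg F\mid\Gamma,\neg G$; $\ \Gamma,F\vee G\leadsto\Gamma,F\mid\Gamma,G$; $\ \Gamma,\neg(F\vee G)\leadsto\Gamma,\neg F,\neg G$; $\ \Gamma,F\rightarrow G\leadsto\Gamma,\neg F\mid\Gamma,G$; $\ \Gamma,\neg(F\rightarrow G)\leadsto\Gamma,F,\neg G$; - $(|\!\sim^+)$: $\Gamma,A\mathrel{|\!\sim}B\leadsto\Gamma,A\mathrel{|\!\sim}B,\neg LA\ \mid\ \Gamma^{|\!\sim^{\pm}},\Gamma^{\Box^{\downarrow}},A\mathrel{|\!\sim}B,LA,\Box\neg LA\ \mid\ \Gamma,A\mathrel{|\!\sim}B,LA,\Box\neg LA,LB$; - $(|\!\sim^-)$: $\Gamma,\neg(A\mathrel{|\!\sim}B)\leadsto LA,\Box\neg LA,\neg LB,\Gamma^{|\!\sim^{\pm}}$; - $(L^-)$: $\Gamma,\neg LA\leadsto\Gamma^{L^{\downarrow}},\neg A$; and, if $\Gamma$ contains no negated $L$-formula $\neg LA$, $\Gamma\leadsto\Gamma^{L^{\downarrow}}$. A tableau for $\Gamma$ is a tree with root $\Gamma$ in which the children of each non-leaf node are the conclusions of a rule applied to that node. A branch is closed if one of its nodes is an instance of (AX);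 a tableau is closed if all its branches are closed. -}

module Defs where

open import Data.Empty using (⊥)
open import Data.List using (List; []; _∷_; [_])
open import Data.List.Membership.Propositional using () renaming (_∈_ to _∈ˡ_)
open import Data.List.Relation.Unary.All using (All; lookup)
open import Data.Product using (Σ-syntax; ∃-syntax; _×_)
open import Data.Sum using (_⊎_)
open import Data.Unit using (⊤)
open import Level using (0ℓ)
open import Relation.Binary.PropositionalEquality using (_≡_)
open import Relation.Unary using (Pred; _∈_; _∉_; _∪_; _≐_; ｛_｝)

private variable
  ATM : Set

infix  9 ∼_ L_ □¬L_
infixr 8 _∧_
infixr 7 _∨_
infixr 6 _⊃_
infix  6 _|~_
infixl 5 _,,_
infix  4 _⇝_

data PForm (ATM : Set) : Set where
  atom        : ATM → PForm ATM
  ∼_          : PForm ATM → PForm ATM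
  _∧_ _∨_ _⊃_ : PForm ATM → PForm ATM → PForm ATM

-- □ only ever occurs in the combination □¬LA, which is therefore a single
-- constructor.  Propositional formulas are not a separate constructor; they
-- are the image of ⌜_⌝ below.
data Form (ATM : Set) : Set where
  atom        : ATM → Form ATM
  ∼_          : Form ATM → Form ATM
  _∧_ _∨_ _⊃_ : Form ATM → Form ATM → Form ATM
  _|~_        : PForm ATM → PForm ATM → Form ATM
  L_ □¬L_     : PForm ATM → Form ATM

⌜_⌝ : PForm ATM → Form ATM
⌜ atom P ⌝ = atom P
⌜ ∼ A ⌝    = ∼ ⌜ A ⌝
⌜ A ∧ B ⌝  = ⌜ A ⌝ ∧ ⌜ B ⌝
⌜ A ∨ B ⌝  = ⌜ A ⌝ ∨ ⌜ B ⌝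
⌜ A ⊃ B ⌝  = ⌜ A ⌝ ⊃ ⌜ B ⌝

-- BoxPos F (BoxNeg F): every □¬LA in F occurs positively (negatively).
-- These are polarities, so ∼ and the left of ⊃ switch between the two.
mutual
  BoxPos : Pred (Form ATM) 0ℓ
  BoxPos (atom P) = ⊤
  BoxPos (∼ F)    = BoxNeg F
  BoxPos (F ∧ G)  = BoxPos F × BoxPos G
  BoxPos (F ∨ G)  = BoxPos F × BoxPos G
  BoxPos (F ⊃ G)  = BoxNeg F × BoxPos G
  BoxPos (A |~ B) = ⊤
  BoxPos (L A)    = ⊤
  BoxPos (□¬L A)  = ⊤

  BoxNeg : Pred (Form ATM) 0ℓ
  BoxNeg (atom P) = ⊤
  BoxNeg (∼ F)    = BoxPos F
  BoxNeg (F ∧ G)  = BoxNeg F × BoxNeg G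
  BoxNeg (F ∨ G)  = BoxNeg F × BoxNeg G
  BoxNeg (F ⊃ G)  = BoxPos F × BoxNeg G
  BoxNeg (A |~ B) = ⊤
  BoxNeg (L A)    = ⊤
  BoxNeg (□¬L A)  = ⊥

𝓛L′ : Pred (Form ATM) 0ℓ
𝓛L′ = BoxPos

-- Arbitrary, possibly infinite, sets of formulas; equality of sets is _≐_.
FSet : Set → Set₁
FSet ATM = Pred (Form ATM) 0ℓ

_,,_ : FSet ATM → Form ATM → FSet ATM
Γ ,, F = Γ ∪ ｛ F ｝

_^□↓ : FSet ATM → FSet ATM
(Γ ^□↓) F = ∃[ A ] F ≡ ∼ L A × (□¬L A) ∈ Γ

_^L↓ : FSet ATM → FSet ATM
(Γ ^L↓) F = ∃[ A ] F ≡ ⌜ A ⌝ × (L A) ∈ Γ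

_^|~± : FSet ATM → FSet ATM
(Γ ^|~±) F = (∃[ A ] ∃[ B ] F ≡ (A |~ B) × (A |~ B) ∈ Γ)
           ⊎ (∃[ A ] ∃[ B ] F ≡ ∼ (A |~ B) × (∼ (A |~ B)) ∈ Γ)

Axiom : FSet ATM → Set₁
Axiom {ATM} N = Σ[ Γ ∈ FSet ATM ] Σ[ P ∈ ATM ] N ≐ Γ ,, atom P ,, ∼ atom P

-- N ⇝ Ns: some rule applied to the node N has the list of conclusions Ns.
-- A premise "Γ, F" is any way of writing N as Γ ∪ {F}; as in the set notation,
-- Γ may or may not itself contain F.
data _⇝_ {ATM : Set} (N : FSet ATM) : List (FSet ATM) → Set₁ where
  ∼∼   : ∀ {Γ F}   → N ≐ Γ ,, ∼ ∼ F     → N ⇝ [ Γ ,, F ]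
  ∧⁺   : ∀ {Γ F G} → N ≐ Γ ,, F ∧ G     → N ⇝ [ Γ ,, F ,, G ]
  ∧⁻   : ∀ {Γ F G} → N ≐ Γ ,, ∼ (F ∧ G) → N ⇝ (Γ ,, ∼ F) ∷ (Γ ,, ∼ G) ∷ []
  ∨⁺   : ∀ {Γ F G} → N ≐ Γ ,, F ∨ G     → N ⇝ (Γ ,, F) ∷ (Γ ,, G) ∷ []
  ∨⁻   : ∀ {Γ F G} → N ≐ Γ ,, ∼ (F ∨ G) → N ⇝ [ Γ ,, ∼ F ,, ∼ G ]
  ⊃⁺   : ∀ {Γ F G} → N ≐ Γ ,, F ⊃ G     → N ⇝ (Γ ,, ∼ F) ∷ (Γ ,, G) ∷ []
  ⊃⁻   : ∀ {Γ F G} → N ≐ Γ ,, ∼ (F ⊃ G) → N ⇝ [ Γ ,, F ,, ∼ G ]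
  |~⁺  : ∀ {Γ A B} → N ≐ Γ ,, A |~ B →
         N ⇝ (Γ ,, A |~ B ,, ∼ L A)
           ∷ ((Γ ^|~±) ∪ (Γ ^□↓) ,, A |~ B ,, L A ,, □¬L A)
           ∷ (Γ ,, A |~ B ,, L A ,, □¬L A ,, L B)
           ∷ []
  |~⁻  : ∀ {Γ A B} → N ≐ Γ ,, ∼ (A |~ B) →
         N ⇝ [ Γ ^|~± ,, L A ,, □¬L A ,, ∼ L B ]
  L⁻   : ∀ {Γ A} → N ≐ Γ ,, ∼ L A → N ⇝ [ Γ ^L↓ ,, ∼ ⌜ A ⌝ ]
  L⁻₀  : (∀ A → (∼ L A) ∉ N) → N ⇝ [ N ^L↓ ]

-- A leaf need not be an axiom, and an axiom node may be expanded further.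
data Tableau {ATM : Set} : FSet ATM → Set₁ where
  leaf : ∀ {N} → Tableau N
  node : ∀ {N Ns} → N ⇝ Ns → All Tableau Ns → Tableau N

-- The maximal (root-to-leaf) branches.
data Branch {ATM : Set} : {N : FSet ATM} → Tableau N → Set₁ where
  end  : ∀ {N} → Branch (leaf {N = N})
  down : ∀ {N Ns M} {r : N ⇝ Ns} {ts : All Tableau Ns} (i : M ∈ˡ Ns) →
         Branch (lookup ts i) → Branch (node r ts)

data ClosedBranch {ATM : Set} :
     {N : FSet ATM} {t : Tableau N} → Branch t → Set₁ where
  here  : ∀ {N} {t : Tableau N} {b : Branch t} → Axiom N → ClosedBranch b
  there : ∀ {N Ns M} {r : N ⇝ Ns} {ts : All Tableau Ns} {i : M ∈ˡ Ns}
          {b : Branch (lookup ts i)} →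
          ClosedBranch b → ClosedBranch (down {r = r} {ts = ts} i b)

Closed : {Γ : FSet ATM} → Tableau Γ → Set₁
Closed t = (b : Branch t) → ClosedBranch b

HasClosedTableau : FSet ATM → Set₁
HasClosedTableau Γ = Σ[ t ∈ Tableau Γ ] Closed t

{-# OPTIONS --safe #-}
module Submission where

-- Closed tableaux are first replaced by an equivalent inductive predicate
-- Refuted, whose rules have no side condition and keep their principal formula
-- wherever the calculus lets them; weakening is then an induction (weaken).
-- One further induction, Elimination.eliminate, says when a side formula H may
-- be dropped from a refuted set; it yields the inversion of the propositional
-- rules, cut on propositional formulas (cut) and cut on L-formulas (cut-L).
--
-- Weak cut itself is an induction on the refutation of Γ , □¬LA.  The formula
-- □¬LA matters at one place only, the second conclusion of the rule for a
-- positive conditional C |~ D, which describes a world v, preferred to the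
-- current world w, with LC and □¬LC; there □¬LA contributes ¬LA.  So what must
-- be refuted is the description of v, given that it is refuted together with
-- ¬LA, that is, given that v would satisfy LA (weak-cut-at).
--
-- The hypothesis on LA , □¬LA excludes an A-minimal world preferred to w.  It
-- does not apply to v, because v need not be A-minimal and preference is not
-- transitive.  Instead the refutation behind it is analysed (clash).  If it uses
-- a negated conditional, it refutes the current set too.  Otherwise it yields
-- conditionals E₁ |~ F₁, ..., Eₙ |~ Fₙ of the current set such that Eᵢ
-- follows from A, E₁, F₁, ..., Eᵢ₋₁, Fᵢ₋₁, no Eᵢ-minimal world can satisfy
-- ¬LA, ¬LE₁, ..., ¬LEᵢ₋₁, and all of these formulas together contradict the
-- boxes at w (a Chain).  If n = 0, then LA alone contradicts the boxes at w,
-- hence is impossible at v.  Otherwise the rule is applied at w to E₁ |~ F₁.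
-- If LE₁ fails at w, so does LA, which is excluded.  If w is E₁-minimal, then
-- no world preferred to w satisfies LA, and C |~ D gives the contradiction.  If
-- some u preferred to w is E₁-minimal, then u satisfies LA, as well as LE₁ and
-- LF₁, and therefore LE₂.  A world preferred to u cannot be E₂-minimal, for it
-- would satisfy ¬LE₁ and so ¬LA; hence u is E₂-minimal and satisfies LF₂, and so
-- on (climb, root).  In the end u contradicts the boxes at w.

open import Defs
open import Axiom.ExcludedMiddle using (ExcludedMiddle)
open import Level using (0ℓ; Lift; lift) renaming (suc to lsuc)
open import Relation.Unary using (Pred; _⊆_; _⊆′_; _∪_; _∈_; _≐_; ｛_｝; ∅)
open import Data.List using (List; []; _∷_; [_])
open import Data.List.Membership.Propositional using () renaming (_∈_ to _∈ˡ_)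
open import Data.List.Relation.Unary.Any using (here; there)
open import Data.List.Relation.Unary.All using (All; []; _∷_; lookup)
open import Data.Product using (Σ-syntax; ∃-syntax; _×_; _,_; proj₂)
open import Data.Sum using (_⊎_; inj₁; inj₂)
open import Relation.Binary.PropositionalEquality using (_≡_; _≢_; refl)
open import Relation.Nullary using (yes; no)

private variable
  ATM : Set

-- Inclusions of sets of formulas

keep : ∀ {A : Set} {P Q : Pred A 0ℓ} → P ⊆′ P ∪ Q
keep _ = inj₁

same : ∀ {A : Set} {P : Pred A 0ℓ} → P ⊆′ P
same _ x = x

∪-mono : ∀ {A : Set} {P P′ Q Q′ : Pred A 0ℓ} → P ⊆′ P′ → Q ⊆′ Q′ → P ∪ Q ⊆′ P′ ∪ Q′
∪-mono f g _ (inj₁ x) = inj₁ (f _ x)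
∪-mono f g _ (inj₂ y) = inj₂ (g _ y)

∪-absorb : ∀ {A : Set} {P Q : Pred A 0ℓ} → Q ⊆′ P → P ∪ Q ⊆′ P
∪-absorb f _ (inj₁ x) = x
∪-absorb f _ (inj₂ y) = f _ y

∪-swap : ∀ {A : Set} {P Q R S : Pred A 0ℓ} → P ⊆′ Q ∪ R → P ∪ S ⊆′ (Q ∪ S) ∪ R
∪-swap f _ (inj₁ x) with f _ x
... | inj₁ q = inj₁ (inj₁ q)
... | inj₂ r = inj₂ r
∪-swap f _ (inj₂ s) = inj₁ (inj₂ s)

,,-mono : ∀ {N M : FSet ATM} {F} → N ⊆′ M → N ,, F ⊆′ M ,, F
,,-mono f = ∪-mono f same

,,-absorb : ∀ {N : FSet ATM} {F} → F ∈ N → N ,, F ⊆′ N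
,,-absorb x = ∪-absorb λ { _ refl → x }

-- The formulas c A with A in X.  Both Γ ^L↓ and Γ ^□↓ are of this form.
image : (PForm ATM → Form ATM) → Pred (PForm ATM) 0ℓ → FSet ATM
image c X F = ∃[ A ] F ≡ c A × A ∈ X

¬L_ : PForm ATM → Form ATM
¬L A = ∼ L A

image-mono : ∀ {c : PForm ATM → Form ATM} {X Y} → X ⊆′ Y → image c X ⊆′ image c Y
image-mono f _ (A , eq , a) = A , eq , f A a

|~±-mono : ∀ {N M : FSet ATM} → N ⊆′ M → N ^|~± ⊆′ M ^|~±
|~±-mono f _ (inj₁ (A , B , eq , x)) = inj₁ (A , B , eq , f _ x)
|~±-mono f _ (inj₂ (A , B , eq , x)) = inj₂ (A , B , eq , f _ x)

□↓-mono : ∀ {N M : FSet ATM} → N ⊆′ M → N ^□↓ ⊆′ M ^□↓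
□↓-mono f _ (A , eq , x) = A , eq , f _ x

L↓-mono : ∀ {N M : FSet ATM} → N ⊆′ M → N ^L↓ ⊆′ M ^L↓
L↓-mono f _ (A , eq , x) = A , eq , f _ x

-- The part of a node, other than LA and □¬LA, that the second conclusion of
-- the rule for a positive conditional passes on to a preferred world.
_^↓ : FSet ATM → FSet ATM
N ^↓ = (N ^|~±) ∪ (N ^□↓)

↓-mono : ∀ {N M : FSet ATM} → N ⊆′ M → N ^↓ ⊆′ M ^↓
↓-mono f = ∪-mono (|~±-mono f) (□↓-mono f)

-- Refutations

-- Expansion F bs: F is the principal formula of a propositional rule, and the
-- lists bs, one for each conclusion, are the formulas that replace it.
data Expansion {ATM : Set} : Form ATM → List (List (Form ATM)) → Set where
  ∼∼ : ∀ {F}   → Expansion (∼ ∼ F)     ((F ∷ []) ∷ [])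
  ∧⁺ : ∀ {F G} → Expansion (F ∧ G)     ((F ∷ G ∷ []) ∷ [])
  ∧⁻ : ∀ {F G} → Expansion (∼ (F ∧ G)) ((∼ F ∷ []) ∷ (∼ G ∷ []) ∷ [])
  ∨⁺ : ∀ {F G} → Expansion (F ∨ G)     ((F ∷ []) ∷ (G ∷ []) ∷ [])
  ∨⁻ : ∀ {F G} → Expansion (∼ (F ∨ G)) ((∼ F ∷ ∼ G ∷ []) ∷ [])
  ⊃⁺ : ∀ {F G} → Expansion (F ⊃ G)     ((∼ F ∷ []) ∷ (G ∷ []) ∷ [])
  ⊃⁻ : ∀ {F G} → Expansion (∼ (F ⊃ G)) ((F ∷ ∼ G ∷ []) ∷ [])

expansion-unique : ∀ {F : Form ATM} {bs cs} →
  Expansion F bs → Expansion F cs → bs ≡ cs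
expansion-unique ∼∼ ∼∼ = refl
expansion-unique ∧⁺ ∧⁺ = refl
expansion-unique ∧⁻ ∧⁻ = refl
expansion-unique ∨⁺ ∨⁺ = refl
expansion-unique ∨⁻ ∨⁻ = refl
expansion-unique ⊃⁺ ⊃⁺ = refl
expansion-unique ⊃⁻ ⊃⁻ = refl

-- Equivalent to having a closed tableau.  A premise Γ , F is always read with
-- F in Γ, the choice that makes the conclusions largest; and L⁻₀ may be used
-- even if N contains formulas ¬LA, since L⁻ then has a larger conclusion.
data Refuted {ATM : Set} (N : FSet ATM) : Set₁ where
  ax     : ∀ {P} → atom P ∈ N → ∼ atom P ∈ N → Refuted N
  expand : ∀ {F bs} → F ∈ N → Expansion F bs →
           (∀ {b} → b ∈ˡ bs → Refuted (N ∪ (_∈ˡ b))) → Refuted N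
  |~⁺    : ∀ {A B} → (A |~ B) ∈ N →
           Refuted (N ,, ∼ L A) →
           Refuted (N ^↓ ,, L A ,, □¬L A) →
           Refuted (N ,, L A ,, □¬L A ,, L B) → Refuted N
  |~⁻    : ∀ {A B} → (∼ (A |~ B)) ∈ N →
           Refuted (N ^|~± ,, L A ,, □¬L A ,, ∼ L B) → Refuted N
  L⁻     : ∀ {A} → (∼ L A) ∈ N → Refuted (N ^L↓ ,, ∼ ⌜ A ⌝) → Refuted N
  L⁻₀    : Refuted (N ^L↓) → Refuted N

weaken : ∀ {N M : FSet ATM} → N ⊆′ M → Refuted N → Refuted M
weaken f (ax p q) = ax (f _ p) (f _ q)
weaken f (expand x e ds) = expand (f _ x) e (λ i → weaken (∪-mono f same) (ds i))
weaken f (|~⁺ x d₁ d₂ d₃) = |~⁺ (f _ x)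
  (weaken (,,-mono f) d₁)
  (weaken (,,-mono (,,-mono (↓-mono f))) d₂)
  (weaken (,,-mono (,,-mono (,,-mono f))) d₃)
weaken f (|~⁻ x d) = |~⁻ (f _ x) (weaken (,,-mono (,,-mono (,,-mono (|~±-mono f)))) d)
weaken f (L⁻ x d) = L⁻ (f _ x) (weaken (,,-mono (L↓-mono f)) d)
weaken f (L⁻₀ d) = L⁻₀ (weaken (L↓-mono f) d)

-- Elimination of a side formula

-- A formula H, not a conditional nor a negated one, can be dropped from a
-- refuted set P , H whenever P satisfies a condition C that is preserved by
-- enlarging P.  The hypotheses on-... are the rules in which H can take part;
-- H has already been dropped from those premises that still contain P.
module Elimination {ATM : Set} (H : Form ATM) (C : FSet ATM → Set₁)
  (C-mono : ∀ {P Q} → P ⊆′ Q → C P → C Q)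
  (not-|~ : ∀ {A B} → H ≢ (A |~ B)) (not-∼|~ : ∀ {A B} → H ≢ ∼ (A |~ B))
  (on-ax : ∀ {P p} → C P → (P ,, H) (atom p) → (P ,, H) (∼ atom p) → Refuted P)
  (on-expand : ∀ {P bs} → C P → Expansion H bs →
    (∀ {b} → b ∈ˡ bs → Refuted (P ∪ (_∈ˡ b))) → Refuted P)
  (on-□ : ∀ {P A B} → C P → (A |~ B) ∈ P →
    Refuted (P ,, ∼ L A) →
    Refuted ((P ^|~±) ∪ ((P ,, H) ^□↓) ,, L A ,, □¬L A) →
    Refuted (P ,, L A ,, □¬L A ,, L B) → Refuted P)
  (on-L⁻ : ∀ {P A} → C P → (P ,, H) (∼ L A) →
    Refuted ((P ,, H) ^L↓ ,, ∼ ⌜ A ⌝) → Refuted P)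
  (on-L⁻₀ : ∀ {P} → C P → Refuted ((P ,, H) ^L↓) → Refuted P)
  where

  strip-|~± : ∀ {P Q} → Q ⊆′ P ,, H → Q ^|~± ⊆′ P ^|~±
  strip-|~± f _ (inj₁ (A , B , eq , x)) with f _ x
  ... | inj₁ y = inj₁ (A , B , eq , y)
  ... | inj₂ h with () ← not-|~ h
  strip-|~± f _ (inj₂ (A , B , eq , x)) with f _ x
  ... | inj₁ y = inj₂ (A , B , eq , y)
  ... | inj₂ h with () ← not-∼|~ h

  eliminate : ∀ {P Q} → Refuted Q → Q ⊆′ P ,, H → C P → Refuted P
  eliminate (ax p q) f c = on-ax c (f _ p) (f _ q)
  eliminate (expand x e ds) f c with f _ x
  ... | inj₁ y = expand y e (λ i → eliminate (ds i) (∪-swap f) (C-mono keep c))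
  ... | inj₂ refl = on-expand c e (λ i → eliminate (ds i) (∪-swap f) (C-mono keep c))
  eliminate (|~⁺ x d₁ d₂ d₃) f c with f _ x
  ... | inj₂ h with () ← not-|~ h
  ... | inj₁ y = on-□ c y
    (eliminate d₁ (∪-swap f) (C-mono keep c))
    (weaken (,,-mono (,,-mono (∪-mono (strip-|~± f) (□↓-mono f)))) d₂)
    (eliminate d₃ (∪-swap (∪-swap (∪-swap f)))
      (C-mono keep (C-mono keep (C-mono keep c))))
  eliminate (|~⁻ x d) f c with f _ x
  ... | inj₁ y = |~⁻ y (weaken (,,-mono (,,-mono (,,-mono (strip-|~± f)))) d)
  ... | inj₂ h with () ← not-∼|~ h
  eliminate (L⁻ x d) f c = on-L⁻ c (f _ x) (weaken (,,-mono (L↓-mono f)) d)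
  eliminate (L⁻₀ d) f c = on-L⁻₀ c (weaken (L↓-mono f) d)

open Elimination using (eliminate)

-- The modal rules for a side formula that takes no part in them.

□↓-strip : ∀ {P : FSet ATM} {H} → (∀ {A} → H ≢ □¬L A) → (P ,, H) ^□↓ ⊆′ P ^□↓
□↓-strip n _ (A , eq , inj₁ x) = A , eq , x
□↓-strip n _ (A , eq , inj₂ h) with () ← n h

L↓-strip : ∀ {P : FSet ATM} {H} → (∀ {A} → H ≢ L A) → (P ,, H) ^L↓ ⊆′ P ^L↓
L↓-strip n _ (A , eq , inj₁ x) = A , eq , x
L↓-strip n _ (A , eq , inj₂ h) with () ← n h

|~⁺-without : ∀ {P : FSet ATM} {H A B} → (∀ {C} → H ≢ □¬L C) → (A |~ B) ∈ P →
  Refuted (P ,, ∼ L A) →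
  Refuted ((P ^|~±) ∪ ((P ,, H) ^□↓) ,, L A ,, □¬L A) →
  Refuted (P ,, L A ,, □¬L A ,, L B) → Refuted P
|~⁺-without {P = P} n x d₁ d₂ d₃ =
  |~⁺ x d₁ (weaken (,,-mono (,,-mono (∪-mono same (□↓-strip {P = P} n)))) d₂) d₃

L⁻-without : ∀ {P : FSet ATM} {H A} → (∀ {C} → H ≢ L C) → H ≢ ∼ L A →
  (P ,, H) (∼ L A) → Refuted ((P ,, H) ^L↓ ,, ∼ ⌜ A ⌝) → Refuted P
L⁻-without {P = P} n n′ (inj₁ x) d = L⁻ x (weaken (,,-mono (L↓-strip {P = P} n)) d)
L⁻-without n n′ (inj₂ h) d with () ← n′ h

L⁻₀-without : ∀ {P : FSet ATM} {H} → (∀ {C} → H ≢ L C) →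
  Refuted ((P ,, H) ^L↓) → Refuted P
L⁻₀-without {P = P} n d = L⁻₀ (weaken (L↓-strip {P = P} n) d)

-- Inversion and cut

-- The propositional rules are invertible.
invert : ∀ {P : FSet ATM} {H bs b} → Expansion H bs → b ∈ˡ bs →
  Refuted (P ,, H) → Refuted (P ∪ (_∈ˡ b))
invert {ATM} {P} {H} {bs} {b} e b∈bs d =
  eliminate H (λ Q → Lift (lsuc 0ℓ) ((_∈ˡ b) ⊆′ Q))
    (λ { f (lift g) → lift (λ _ x → f _ (g _ x)) })
    (not-|~ e) (not-∼|~ e)
    (λ {Q} _ → on-ax {Q} e)
    (λ { (lift g) e′ ds → on-expand (expansion-unique e e′) g ds })
    (λ _ → |~⁺-without (not-□ e))
    (λ _ → L⁻-without (not-L e) (not-∼L e))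
    (λ _ → L⁻₀-without (not-L e))
    d (,,-mono keep) (lift (λ _ → inj₂))
  where
  not-|~ : ∀ {F bs A B} → Expansion F bs → F ≢ (A |~ B)
  not-|~ () refl
  not-∼|~ : ∀ {F bs A B} → Expansion F bs → F ≢ ∼ (A |~ B)
  not-∼|~ () refl
  not-□ : ∀ {F bs A} → Expansion F bs → F ≢ □¬L A
  not-□ () refl
  not-L : ∀ {F bs A} → Expansion F bs → F ≢ L A
  not-L () refl
  not-∼L : ∀ {F bs A} → Expansion F bs → F ≢ ∼ L A
  not-∼L () refl
  on-ax : ∀ {Q F bs p} → Expansion F bs →
    (Q ,, F) (atom p) → (Q ,, F) (∼ atom p) → Refuted Q
  on-ax e (inj₁ x) (inj₁ y) = ax x y
  on-ax () (inj₂ refl) _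
  on-ax () (inj₁ _) (inj₂ refl)
  on-expand : ∀ {Q cs} → bs ≡ cs → (_∈ˡ b) ⊆′ Q →
    (∀ {c} → c ∈ˡ cs → Refuted (Q ∪ (_∈ˡ c))) → Refuted Q
  on-expand refl g ds = weaken (∪-absorb g) (ds b∈bs)

singleton⊆ : ∀ {P : FSet ATM} {F} → P ∪ (_∈ˡ [ F ]) ⊆′ P ,, F
singleton⊆ _ (inj₁ x) = inj₁ x
singleton⊆ _ (inj₂ (here refl)) = inj₂ refl

pair⊆ : ∀ {P : FSet ATM} {F G} → P ∪ (_∈ˡ (F ∷ [ G ])) ⊆′ P ,, F ,, G
pair⊆ _ (inj₁ x) = inj₁ (inj₁ x)
pair⊆ _ (inj₂ (here refl)) = inj₁ (inj₂ refl)
pair⊆ _ (inj₂ (there (here refl))) = inj₂ refl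

invert₁ : ∀ {P : FSet ATM} {H bs F} → Expansion H bs → [ F ] ∈ˡ bs →
  Refuted (P ,, H) → Refuted (P ,, F)
invert₁ e i d = weaken singleton⊆ (invert e i d)

invert₂ : ∀ {P : FSet ATM} {H bs F G} → Expansion H bs → (F ∷ [ G ]) ∈ˡ bs →
  Refuted (P ,, H) → Refuted (P ,, F ,, G)
invert₂ e i d = weaken pair⊆ (invert e i d)

cut-atom : ∀ {P : FSet ATM} p →
  Refuted (P ,, atom p) → Refuted (P ,, ∼ atom p) → Refuted P
cut-atom {ATM} p d d′ = eliminate (∼ atom p) (λ Q → Refuted (Q ,, atom p))
  (λ f → weaken (,,-mono f)) (λ ()) (λ ())
  (λ {Q} → on-ax {Q})
  (λ _ ())
  (λ _ → |~⁺-without (λ ()))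
  (λ _ → L⁻-without (λ ()) (λ ()))
  (λ _ → L⁻₀-without (λ ()))
  d′ same d
  where
  on-ax : ∀ {Q : FSet ATM} {q} → Refuted (Q ,, atom p) →
    (Q ,, ∼ atom p) (atom q) → (Q ,, ∼ atom p) (∼ atom q) → Refuted Q
  on-ax c (inj₁ x) (inj₁ y) = ax x y
  on-ax c (inj₁ x) (inj₂ refl) = weaken (,,-absorb x) c

cut : ∀ {P : FSet ATM} A → Refuted (P ,, ⌜ A ⌝) → Refuted (P ,, ∼ ⌜ A ⌝) → Refuted P
cut (atom p) d d′ = cut-atom p d d′
cut (∼ A) d d′ = cut A (invert₁ ∼∼ (here refl) d′) d
cut (A ∧ B) d d′ =
  cut A
    (cut B (invert₂ ∧⁺ (here refl) d)
           (weaken (,,-mono keep) (invert₁ ∧⁻ (there (here refl)) d′)))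
    (invert₁ ∧⁻ (here refl) d′)
cut (A ∨ B) d d′ =
  cut A
    (invert₁ ∨⁺ (here refl) d)
    (cut B (weaken (,,-mono keep) (invert₁ ∨⁺ (there (here refl)) d))
           (invert₂ ∨⁻ (here refl) d′))
cut (A ⊃ B) d d′ =
  cut A
    (cut B (weaken (,,-mono keep) (invert₁ ⊃⁺ (there (here refl)) d))
           (invert₂ ⊃⁻ (here refl) d′))
    (invert₁ ⊃⁺ (here refl) d)

-- Cut on LA in the case where ¬LA is refuted by the rule L⁻ applied to it.
cut-L-principal : ∀ {P : FSet ATM} {A} →
  Refuted (P ,, L A) → Refuted (P ^L↓ ,, ∼ ⌜ A ⌝) → Refuted P
cut-L-principal {ATM} {A = A} d d′ =
  eliminate (L A) (λ Q → Refuted (Q ^L↓ ,, ∼ ⌜ A ⌝))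
    (λ f → weaken (,,-mono (L↓-mono f))) (λ ()) (λ ())
    (λ { _ (inj₁ x) (inj₁ y) → ax x y })
    (λ _ ())
    (λ _ → |~⁺-without (λ ()))
    (λ { {Q} c (inj₁ x) e → L⁻ x (cut A (weaken (∪-swap (split {Q})) e) (weaken (,,-mono keep) c)) })
    (λ {Q} c e → L⁻₀ (cut A (weaken (split {Q}) e) c))
    d same d′
  where
  split : ∀ {Q : FSet ATM} → (Q ,, L A) ^L↓ ⊆′ Q ^L↓ ,, ⌜ A ⌝
  split _ (B , eq , inj₁ x) = inj₁ (B , eq , x)
  split _ (B , refl , inj₂ refl) = inj₂ refl

cut-L : ∀ {P : FSet ATM} {A} → Refuted (P ,, L A) → Refuted (P ,, ∼ L A) → Refuted P
cut-L {ATM} {A = A} d d′ = eliminate (∼ L A) (λ Q → Refuted (Q ,, L A))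
  (λ f → weaken (,,-mono f)) (λ ()) (λ ())
  (λ { _ (inj₁ x) (inj₁ y) → ax x y })
  (λ _ ())
  (λ _ → |~⁺-without (λ ()))
  (λ {Q} → on-L⁻ {Q})
  (λ _ → L⁻₀-without (λ ()))
  d′ same d
  where
  on-L⁻ : ∀ {Q : FSet ATM} {B} → Refuted (Q ,, L A) → (Q ,, ∼ L A) (∼ L B) →
    Refuted ((Q ,, ∼ L A) ^L↓ ,, ∼ ⌜ B ⌝) → Refuted Q
  on-L⁻ {Q} c (inj₁ x) e = L⁻ x (weaken (,,-mono (L↓-strip {P = Q} (λ ()))) e)
  on-L⁻ {Q} c (inj₂ refl) e =
    cut-L-principal c (weaken (,,-mono (L↓-strip {P = Q} (λ ()))) e)

-- Propositional entailment.
_⊢_ : Pred (PForm ATM) 0ℓ → PForm ATM → Set₁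
Y ⊢ E = Refuted (image ⌜_⌝ Y ,, ∼ ⌜ E ⌝)

L⁻-⊢ : ∀ {P : FSet ATM} {Y E} → Y ⊢ E → image L_ Y ⊆′ P → (∼ L E) ∈ P → Refuted P
L⁻-⊢ y⊢e f x = L⁻ x (weaken (,,-mono λ { _ (B , eq , y) → B , eq , f _ (B , refl , y) }) y⊢e)

-- If P entails LA, then P entails LE for every consequence E of A.
¬L-mono : ∀ {P : FSet ATM} {A E} → ｛ A ｝ ⊢ E → Refuted (P ,, ∼ L A) → Refuted (P ,, ∼ L E)
¬L-mono a⊢e d = cut-L
  (L⁻-⊢ a⊢e (λ { _ (_ , refl , refl) → inj₂ refl }) (inj₁ (inj₂ refl)))
  (weaken (,,-mono keep) d)

-- Chains of conditionals

module Chains {ATM : Set} (N : FSet ATM) (A : PForm ATM) where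

  -- Chain Y Z: Y consists of A and the antecedents and consequents of a
  -- sequence of conditionals E |~ F of N; Z, of their antecedents.  Each E
  -- follows from what precedes it in Y, and an E-minimal world satisfying the
  -- conditionals of N must satisfy LA, or LZ for an earlier antecedent Z.
  data Chain : Pred (PForm ATM) 0ℓ → Pred (PForm ATM) 0ℓ → Set₁ where
    start : Chain ｛ A ｝ ∅
    step  : ∀ {Y Z E F} → Chain Y Z → (E |~ F) ∈ N → Y ⊢ E →
            Refuted ((N ^|~±) ∪ image ¬L_ Z ,, L E ,, □¬L E ,, ∼ L A) →
            Chain (Y ∪ ｛ E ｝ ∪ ｛ F ｝) (Z ∪ ｛ E ｝)

  -- The set of formulas LE for E in Y, and ¬LE for E in X, contradicts itself
  -- by way of the rules for L.
  Conflict : (Y X : Pred (PForm ATM) 0ℓ) → Set₁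
  Conflict Y X = Refuted (image ⌜_⌝ Y) ⊎ Σ[ E ∈ PForm ATM ] E ∈ X × Y ⊢ E

  -- The pair (Y , Z) can be extended to a chain that conflicts with X.
  Clash : (Y Z X : Pred (PForm ATM) 0ℓ) → Set₁
  Clash Y Z X = Σ[ Y′ ∈ Pred (PForm ATM) 0ℓ ] Σ[ Z′ ∈ Pred (PForm ATM) 0ℓ ]
    Y ⊆′ Y′ × Z ⊆′ Z′ × Chain Y′ Z′ × Conflict Y′ X

  -- An A-minimal world in which the conditionals of N and the formulas LY, □¬LZ
  -- and ¬LX hold.
  data World (Y Z X : Pred (PForm ATM) 0ℓ) : FSet ATM where
    cond⁺   : ∀ {E F} → (E |~ F) ∈ N → World Y Z X (E |~ F)
    cond⁻   : ∀ {E F} → (∼ (E |~ F)) ∈ N → World Y Z X (∼ (E |~ F))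
    holds   : ∀ {E} → E ∈ Y → World Y Z X (L E)
    minimal : ∀ {E} → (｛ A ｝ ∪ Z) E → World Y Z X (□¬L E)
    fails   : ∀ {E} → E ∈ X → World Y Z X (∼ L E)

  World-mono : ∀ {Y Y′ Z Z′ X X′} → Y ⊆′ Y′ → Z ⊆′ Z′ → X ⊆′ X′ →
    World Y Z X ⊆′ World Y′ Z′ X′
  World-mono f g h _ (cond⁺ x) = cond⁺ x
  World-mono f g h _ (cond⁻ x) = cond⁻ x
  World-mono f g h _ (holds x) = holds (f _ x)
  World-mono f g h _ (minimal (inj₁ eq)) = minimal (inj₁ eq)
  World-mono f g h _ (minimal (inj₂ x)) = minimal (inj₂ (g _ x))
  World-mono f g h _ (fails x) = fails (h _ x)

  World-|~± : ∀ {Δ Y Z X} → Δ ⊆′ World Y Z X → Δ ^|~± ⊆′ N ^|~±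
  World-|~± f _ (inj₁ (_ , _ , eq , x)) with cond⁺ y ← f _ x = inj₁ (_ , _ , eq , y)
  World-|~± f _ (inj₂ (_ , _ , eq , x)) with cond⁻ y ← f _ x = inj₂ (_ , _ , eq , y)

  World-L↓ : ∀ {Δ Y Z X} → Δ ⊆′ World Y Z X → Δ ^L↓ ⊆′ image ⌜_⌝ Y
  World-L↓ f _ (E , eq , x) with holds y ← f _ x = E , eq , y

  -- A refutation of such a world produces a chain, unless it applies the rule for
  -- negated conditionals, whose conclusion N shares.  At a conditional E |~ F, the
  -- premise with ¬LE is explored first.  If the clash found there comes from
  -- ¬LE, then the extended chain entails E; the second premise makes E |~ F
  -- its next step, and the third premise is explored with the longer chain.
  clash : ∀ {Y Z X Δ} → Chain Y Z → Refuted Δ → Δ ⊆′ World Y Z X → Refuted N ⊎ Clash Y Z X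
  clash ch (ax p q) f with () ← f _ p
  clash ch (expand x e ds) f with f _ x
  clash ch (expand x () ds) f | cond⁺ _
  clash ch (expand x () ds) f | cond⁻ _
  clash ch (expand x () ds) f | holds _
  clash ch (expand x () ds) f | minimal _
  clash ch (expand x () ds) f | fails _
  clash ch (|~⁻ x d) f with cond⁻ y ← f _ x =
    inj₁ (|~⁻ y (weaken (,,-mono (,,-mono (,,-mono (World-|~± f)))) d))
  clash ch (L⁻ x d) f with fails y ← f _ x =
    inj₂ (_ , _ , same , same , ch , inj₂ (_ , y , weaken (,,-mono (World-L↓ f)) d))
  clash ch (L⁻₀ d) f =
    inj₂ (_ , _ , same , same , ch , inj₁ (weaken (World-L↓ f) d))
  clash {Y} {Z} {X} {Δ} ch (|~⁺ {E} {F} x d₁ d₂ d₃) f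
    with cond⁺ x∈N ← f _ x
    with clash {X = X ∪ ｛ E ｝} ch d₁ sub
    where
    sub : Δ ,, ∼ L E ⊆′ World Y Z (X ∪ ｛ E ｝)
    sub _ (inj₁ y) = World-mono same same keep _ (f _ y)
    sub _ (inj₂ refl) = fails (inj₂ refl)
  ... | inj₁ r = inj₁ r
  ... | inj₂ (Y′ , Z′ , g , h , ch′ , inj₁ r) = inj₂ (Y′ , Z′ , g , h , ch′ , inj₁ r)
  ... | inj₂ (Y′ , Z′ , g , h , ch′ , inj₂ (G , inj₁ G∈X , r)) =
    inj₂ (Y′ , Z′ , g , h , ch′ , inj₂ (G , G∈X , r))
  ... | inj₂ (Y′ , Z′ , g , h , ch′ , inj₂ (G , inj₂ refl , y⊢e))
    with clash {X = X} (step ch′ x∈N y⊢e (weaken sub₂ d₂)) d₃ sub₃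
    where
    sub₂ : Δ ^↓ ,, L E ,, □¬L E ⊆′ (N ^|~±) ∪ image ¬L_ Z′ ,, L E ,, □¬L E ,, ∼ L A
    sub₂ _ (inj₁ (inj₁ (inj₁ y))) = inj₁ (inj₁ (inj₁ (inj₁ (World-|~± f _ y))))
    sub₂ _ (inj₁ (inj₁ (inj₂ (B , refl , y)))) with f _ y
    ... | minimal (inj₁ refl) = inj₂ refl
    ... | minimal (inj₂ z) = inj₁ (inj₁ (inj₁ (inj₂ (B , refl , h _ z))))
    sub₂ _ (inj₁ (inj₂ refl)) = inj₁ (inj₁ (inj₂ refl))
    sub₂ _ (inj₂ refl) = inj₁ (inj₂ refl)
    sub₃ : Δ ,, L E ,, □¬L E ,, L F ⊆′ World (Y′ ∪ ｛ E ｝ ∪ ｛ F ｝) (Z′ ∪ ｛ E ｝) X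
    sub₃ _ (inj₁ (inj₁ (inj₁ y))) =
      World-mono (λ _ v → inj₁ (g _ v)) (λ _ v → inj₁ (h _ v)) same _ (f _ y)
    sub₃ _ (inj₁ (inj₁ (inj₂ refl))) = holds (inj₂ (inj₁ refl))
    sub₃ _ (inj₁ (inj₂ refl)) = minimal (inj₂ (inj₂ refl))
    sub₃ _ (inj₂ refl) = holds (inj₂ (inj₂ refl))
  ... | inj₁ r = inj₁ r
  ... | inj₂ (Y″ , Z″ , g′ , h′ , ch″ , r) =
    inj₂ (Y″ , Z″ , (λ _ y → g′ _ (inj₁ (g _ y))) , (λ _ z → h′ _ (inj₁ (h _ z))) , ch″ , r)

  -- An E-minimal world preferred to the world described by N.
  Below : PForm ATM → FSet ATM
  Below E = N ^↓ ,, L E ,, □¬L E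

  Below-∋ : ∀ {E} → N ^|~± ⊆′ Below E
  Below-∋ _ x = inj₁ (inj₁ (inj₁ x))

  Below-|~± : ∀ {E} → N ^|~± ⊆′ Below E ^|~±
  Below-|~± _ (inj₁ (_ , _ , refl , x)) = inj₁ (_ , _ , refl , Below-∋ _ (inj₁ (_ , _ , refl , x)))
  Below-|~± _ (inj₂ (_ , _ , refl , x)) = inj₂ (_ , _ , refl , Below-∋ _ (inj₂ (_ , _ , refl , x)))

  -- An E₁-minimal world W that satisfies LY and is Z-minimal for all earlier
  -- antecedents Z also satisfies LE, □¬LE and LF for the next step E |~ F.  A
  -- world preferred to W that is E-minimal satisfies ¬LE₁, hence ¬LA, and all
  -- of the ¬LZ, which the step excludes.
  climb : ∀ {E₁ W Y Z E F} → ｛ A ｝ ⊢ E₁ → Below E₁ ⊆′ W →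
    image L_ Y ⊆′ W → image □¬L_ Z ⊆′ W →
    (E |~ F) ∈ N → Y ⊢ E →
    Refuted ((N ^|~±) ∪ image ¬L_ Z ,, L E ,, □¬L E ,, ∼ L A) →
    Refuted (W ,, L E ,, □¬L E ,, L F) → Refuted W
  climb {E₁} {W} {Y} {Z} {E} a⊢e₁ b y z x y⊢e d₂ d₃ = |~⁺
    (b _ (Below-∋ _ (inj₁ (_ , _ , refl , x))))
    (L⁻-⊢ y⊢e (λ _ v → inj₁ (y _ v)) (inj₂ refl))
    (weaken sub (¬L-mono a⊢e₁ d₂))
    d₃
    where
    sub : (N ^|~±) ∪ image ¬L_ Z ,, L E ,, □¬L E ,, ∼ L E₁ ⊆′ W ^↓ ,, L E ,, □¬L E
    sub _ (inj₁ (inj₁ (inj₁ (inj₁ v)))) = inj₁ (inj₁ (inj₁ (|~±-mono b _ (Below-|~± _ v))))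
    sub _ (inj₁ (inj₁ (inj₁ (inj₂ (B , eq , v))))) = inj₁ (inj₁ (inj₂ (B , eq , z _ (B , refl , v))))
    sub _ (inj₁ (inj₁ (inj₂ v))) = inj₁ (inj₂ v)
    sub _ (inj₁ (inj₂ v)) = inj₂ v
    sub _ (inj₂ refl) = inj₁ (inj₁ (inj₂ (_ , refl , b _ (inj₂ refl))))

  -- E |~ F is a conditional of N, E follows from A, and an E-minimal world
  -- preferred to the world described by N may be assumed to satisfy LY and □¬LZ.
  Rooted : (Y Z : Pred (PForm ATM) 0ℓ) → Set₁
  Rooted Y Z = Σ[ E ∈ PForm ATM ] Σ[ F ∈ PForm ATM ] (E |~ F) ∈ N × ｛ A ｝ ⊢ E ×
    (Refuted (Below E ∪ (image L_ Y ∪ image □¬L_ Z)) → Refuted (Below E))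

  grow : ∀ {U : FSet ATM} {Y Z E F} →
    U ∪ (image L_ (Y ∪ ｛ E ｝ ∪ ｛ F ｝) ∪ image □¬L_ (Z ∪ ｛ E ｝)) ⊆′
    U ∪ (image L_ Y ∪ image □¬L_ Z) ,, L E ,, □¬L E ,, L F
  grow _ (inj₁ u) = inj₁ (inj₁ (inj₁ (inj₁ u)))
  grow _ (inj₂ (inj₁ (_ , refl , inj₁ y))) = inj₁ (inj₁ (inj₁ (inj₂ (inj₁ (_ , refl , y)))))
  grow _ (inj₂ (inj₁ (_ , refl , inj₂ (inj₁ refl)))) = inj₁ (inj₁ (inj₂ refl))
  grow _ (inj₂ (inj₁ (_ , refl , inj₂ (inj₂ refl)))) = inj₂ refl
  grow _ (inj₂ (inj₂ (_ , refl , inj₁ z))) = inj₁ (inj₁ (inj₁ (inj₂ (inj₂ (_ , refl , z)))))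
  grow _ (inj₂ (inj₂ (_ , refl , inj₂ refl))) = inj₁ (inj₂ refl)

  -- A chain is trivial, or its first conditional has the property Rooted.
  root : ∀ {Y Z} → Chain Y Z → (Y ⊆′ ｛ A ｝ × Z ⊆′ ∅) ⊎ Rooted Y Z
  root start = inj₁ (same , same)
  root (step {Y} {Z} {E} {F} ch x y⊢e d) with root ch
  ... | inj₂ (E₁ , F₁ , x₁ , a⊢e₁ , k) = inj₂ (E₁ , F₁ , x₁ , a⊢e₁ , λ r →
    k (climb a⊢e₁ keep (λ _ y → inj₂ (inj₁ y)) (λ _ z → inj₂ (inj₂ z)) x y⊢e d
        (weaken grow r)))
  ... | inj₁ (ya , z∅) = inj₂ (E , F , x , a⊢e , λ r →
    -- The step says that this world satisfies LA, which a cut makes available.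
    cut-L (climb a⊢e keep ly (λ _ (_ , _ , z) → absurd z) x y⊢e d
             (weaken (λ v w → ,,-mono (,,-mono (,,-mono shrink)) v (grow {Below E} v w)) r))
          (weaken (,,-mono (,,-mono (,,-mono sub))) d))
    where
    absurd : ∀ {B : PForm ATM} {R : Set} → B ∈ Z → R
    absurd z with () ← z∅ _ z
    a⊢e : ｛ A ｝ ⊢ E
    a⊢e = weaken (,,-mono (image-mono ya)) y⊢e
    ly : image L_ Y ⊆′ Below E ,, L A
    ly _ (_ , refl , y) with refl ← ya _ y = inj₂ refl
    shrink : Below E ∪ (image L_ Y ∪ image □¬L_ Z) ⊆′ Below E ,, L A
    shrink _ (inj₁ v) = inj₁ v
    shrink _ (inj₂ (inj₁ v)) = ly _ v
    shrink _ (inj₂ (inj₂ (_ , _ , z))) = absurd z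
    sub : (N ^|~±) ∪ image ¬L_ Z ⊆′ N ^↓
    sub _ (inj₁ v) = inj₁ v
    sub _ (inj₂ (_ , _ , z)) = absurd z

  -- The premises with C are those of the rule for C |~ D, except that the
  -- preferred world is only known to be refuted together with ¬LA.
  weak-cut-at : ∀ {C D} → (C |~ D) ∈ N →
    Refuted (N ,, ∼ L A) → Refuted (Below A) →
    Refuted (N ,, ∼ L C) → Refuted (Below C ,, ∼ L A) →
    Refuted (N ,, L C ,, □¬L C ,, L D) → Refuted N
  weak-cut-at {C} {D} x d₁ d₂ c₁ c₂ c₃ with clash start d₂ sub
    where
    sub : Below A ⊆′ World ｛ A ｝ ∅ (λ G → N (□¬L G))
    sub _ (inj₁ (inj₁ (inj₁ (inj₁ (_ , _ , refl , v))))) = cond⁺ v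
    sub _ (inj₁ (inj₁ (inj₁ (inj₂ (_ , _ , refl , v))))) = cond⁻ v
    sub _ (inj₁ (inj₁ (inj₂ (_ , refl , v)))) = fails v
    sub _ (inj₁ (inj₂ refl)) = holds refl
    sub _ (inj₂ refl) = minimal (inj₁ refl)
  ... | inj₁ r = r
  ... | inj₂ (Y , Z , _ , _ , ch , conflict) = conclude (root ch)
    where
    refute : Conflict Y (λ G → N (□¬L G)) → Refuted ((N ^□↓) ∪ image L_ Y)
    refute (inj₁ r) = L⁻₀ (weaken (image-mono (λ _ y → inj₂ (_ , refl , y))) r)
    refute (inj₂ (G , g , y⊢g)) = L⁻-⊢ y⊢g (λ _ → inj₂) (inj₁ (_ , refl , g))

    conclude : (Y ⊆′ ｛ A ｝ × Z ⊆′ ∅) ⊎ Rooted Y Z → Refuted N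
    conclude (inj₁ (ya , _)) = |~⁺ x c₁ (cut-L (weaken sub (refute conflict)) c₂) c₃
      where
      sub : (N ^□↓) ∪ image L_ Y ⊆′ Below C ,, L A
      sub _ (inj₁ v) = inj₁ (inj₁ (inj₁ (inj₂ v)))
      sub _ (inj₂ (_ , refl , y)) with refl ← ya _ y = inj₂ refl
    conclude (inj₂ (E , F , x′ , a⊢e , k)) = |~⁺ x′
      (¬L-mono a⊢e d₁)
      (k (weaken sub (refute conflict)))
      -- Here □¬LE is available, so that the world preferred for C |~ D
      -- satisfies ¬LE, hence ¬LA.
      (|~⁺ (up _ x)
        (weaken (,,-mono up) c₁)
        (weaken sub′ (¬L-mono a⊢e c₂))
        (weaken (,,-mono (,,-mono (,,-mono up))) c₃))
      where
      sub : (N ^□↓) ∪ image L_ Y ⊆′ Below E ∪ (image L_ Y ∪ image □¬L_ Z)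
      sub _ (inj₁ v) = inj₁ (inj₁ (inj₁ (inj₂ v)))
      sub _ (inj₂ v) = inj₂ (inj₁ v)
      up : N ⊆′ N ,, L E ,, □¬L E ,, L F
      up _ v = inj₁ (inj₁ (inj₁ v))
      sub′ : Below C ,, ∼ L E ⊆′ (N ,, L E ,, □¬L E ,, L F) ^↓ ,, L C ,, □¬L C
      sub′ _ (inj₁ v) = ,,-mono (,,-mono (↓-mono up)) _ v
      sub′ _ (inj₂ refl) = inj₁ (inj₁ (inj₂ (_ , refl , inj₁ (inj₂ refl))))

weak-cut : ∀ {Γ : FSet ATM} {A} →
  Refuted (Γ ,, ∼ L A) → Refuted (Γ ^↓ ,, L A ,, □¬L A) → Refuted (Γ ,, □¬L A) →
  Refuted Γ
weak-cut {ATM} {Γ} {A} d₁ d₂ d₃ = eliminate (□¬L A)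
  (λ P → Refuted (P ,, ∼ L A) × Refuted (P ^↓ ,, L A ,, □¬L A))
  (λ f (c₁ , c₂) → weaken (,,-mono f) c₁ , weaken (,,-mono (,,-mono (↓-mono f))) c₂)
  (λ ()) (λ ())
  (λ { _ (inj₁ x) (inj₁ y) → ax x y })
  (λ _ ())
  (λ { {P} (c₁ , c₂) x e₁ e₂ e₃ →
     Chains.weak-cut-at P A x c₁ c₂ e₁ (weaken (split {P}) e₂) e₃ })
  (λ _ → L⁻-without (λ ()) (λ ()))
  (λ _ → L⁻₀-without (λ ()))
  d₃ same (d₁ , d₂)
  where
  split : ∀ {P : FSet ATM} {C} → (P ^|~±) ∪ ((P ,, □¬L A) ^□↓) ,, L C ,, □¬L C ⊆′
                                 P ^↓ ,, L C ,, □¬L C ,, ∼ L A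
  split _ (inj₁ (inj₁ (inj₁ v))) = inj₁ (inj₁ (inj₁ (inj₁ v)))
  split _ (inj₁ (inj₁ (inj₂ (B , eq , inj₁ v)))) = inj₁ (inj₁ (inj₁ (inj₂ (B , eq , v))))
  split _ (inj₁ (inj₁ (inj₂ (B , refl , inj₂ refl)))) = inj₂ refl
  split _ (inj₁ (inj₂ v)) = inj₁ (inj₁ (inj₂ v))
  split _ (inj₂ v) = inj₁ (inj₂ v)

-- From refutations to closed tableaux

-- Closed tableaux for all sets in a list.
Closing : List (FSet ATM) → Set₁
Closing Ns = Σ[ ts ∈ All Tableau Ns ] (∀ {M} (i : M ∈ˡ Ns) → Closed (lookup ts i))

[]ᶜ : Closing {ATM} []
[]ᶜ = [] , λ ()

infixr 5 _∷ᶜ_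
_∷ᶜ_ : ∀ {N : FSet ATM} {Ns} → HasClosedTableau N → Closing Ns → Closing (N ∷ Ns)
(t , c) ∷ᶜ (ts , cs) = t ∷ ts , λ { (here refl) → c ; (there i) → cs i }

close : ∀ {N : FSet ATM} {Ns} → N ⇝ Ns → Closing Ns → HasClosedTableau N
close r (ts , cs) = node r ts , λ { (down i b) → there (cs i b) }

absorbed : ∀ {N : FSet ATM} {F} → F ∈ N → N ≐ N ,, F
absorbed x = inj₁ , λ {y} → ,,-absorb x y

close-axiom : ∀ {N : FSet ATM} {P} → atom P ∈ N → ∼ atom P ∈ N → HasClosedTableau N
close-axiom {N = N} {P} p q = leaf , λ { end → here (N , P , (λ x → inj₁ (inj₁ x)) , sub) }
  where
  sub : N ,, atom P ,, ∼ atom P ⊆ N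
  sub (inj₁ (inj₁ x)) = x
  sub (inj₁ (inj₂ refl)) = p
  sub (inj₂ refl) = q

close-expansion : ∀ {N M : FSet ATM} {F bs} → N ⊆′ M → F ∈ M → Expansion F bs →
  (∀ {b K} → b ∈ˡ bs → N ∪ (_∈ˡ b) ⊆′ K → HasClosedTableau K) → HasClosedTableau M
close-expansion {ATM} {N} {M} f x = λ where
    ∼∼ k → close (∼∼ (absorbed x)) (k (here refl) one ∷ᶜ []ᶜ)
    ∧⁺ k → close (∧⁺ (absorbed x)) (k (here refl) two ∷ᶜ []ᶜ)
    ∧⁻ k → close (∧⁻ (absorbed x)) (k (here refl) one ∷ᶜ k (there (here refl)) one ∷ᶜ []ᶜ)
    ∨⁺ k → close (∨⁺ (absorbed x)) (k (here refl) one ∷ᶜ k (there (here refl)) one ∷ᶜ []ᶜ)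
    ∨⁻ k → close (∨⁻ (absorbed x)) (k (here refl) two ∷ᶜ []ᶜ)
    ⊃⁺ k → close (⊃⁺ (absorbed x)) (k (here refl) one ∷ᶜ k (there (here refl)) one ∷ᶜ []ᶜ)
    ⊃⁻ k → close (⊃⁻ (absorbed x)) (k (here refl) two ∷ᶜ []ᶜ)
  where
  one : ∀ {F} → N ∪ (_∈ˡ [ F ]) ⊆′ M ,, F
  one _ v = ,,-mono f _ (singleton⊆ {P = N} _ v)
  two : ∀ {F G} → N ∪ (_∈ˡ (F ∷ [ G ])) ⊆′ M ,, F ,, G
  two _ v = ,,-mono (,,-mono f) _ (pair⊆ {P = N} _ v)

-- Excluded middle decides whether L⁻ or L⁻₀ applies.
fromRefuted : ExcludedMiddle (lsuc 0ℓ) → ∀ {N M : FSet ATM} →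
  Refuted N → N ⊆′ M → HasClosedTableau M
fromRefuted em (ax p q) f = close-axiom (f _ p) (f _ q)
fromRefuted em (expand x e ds) f =
  close-expansion f (f _ x) e (λ i → fromRefuted em (ds i))
fromRefuted em (|~⁺ x d₁ d₂ d₃) f = close (|~⁺ (absorbed (f _ x)))
  ( fromRefuted em d₁ (,,-mono (λ _ v → inj₁ (f _ v)))
  ∷ᶜ fromRefuted em d₂ (,,-mono (,,-mono (λ _ v → inj₁ (↓-mono f _ v))))
  ∷ᶜ fromRefuted em d₃ (,,-mono (,,-mono (,,-mono (λ _ v → inj₁ (f _ v)))))
  ∷ᶜ []ᶜ )
fromRefuted em (|~⁻ x d) f = close (|~⁻ (absorbed (f _ x)))
  (fromRefuted em d (,,-mono (,,-mono (,,-mono (|~±-mono f)))) ∷ᶜ []ᶜ)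
fromRefuted em (L⁻ x d) f = close (L⁻ (absorbed (f _ x)))
  (fromRefuted em d (,,-mono (L↓-mono f)) ∷ᶜ []ᶜ)
fromRefuted em {M = M} (L⁻₀ d) f with em {Lift (lsuc 0ℓ) (∃[ A ] M (∼ L A))}
... | yes (lift (A , x)) =
  close (L⁻ (absorbed x)) (fromRefuted em d (λ _ v → inj₁ (L↓-mono f _ v)) ∷ᶜ []ᶜ)
... | no none =
  close (L⁻₀ (λ A x → none (lift (A , x)))) (fromRefuted em d (L↓-mono f) ∷ᶜ []ᶜ)

-- From closed tableaux to refutations

side : ∀ {N Γ : FSet ATM} {F} → N ≐ Γ ,, F → Γ ⊆′ N
side n _ x = proj₂ n (inj₁ x)

whole : ∀ {N Γ : FSet ATM} {F} → N ≐ Γ ,, F → Γ ,, F ⊆′ N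
whole n _ x = proj₂ n x

principal : ∀ {N Γ : FSet ATM} {F} → N ≐ Γ ,, F → F ∈ N
principal n = proj₂ n (inj₂ refl)

⊆singleton : ∀ {Γ N : FSet ATM} {F} → Γ ⊆′ N → Γ ,, F ⊆′ N ∪ (_∈ˡ [ F ])
⊆singleton f _ (inj₁ v) = inj₁ (f _ v)
⊆singleton f _ (inj₂ refl) = inj₂ (here refl)

⊆pair : ∀ {Γ N : FSet ATM} {F G} → Γ ⊆′ N → Γ ,, F ,, G ⊆′ N ∪ (_∈ˡ (F ∷ [ G ]))
⊆pair f _ (inj₁ (inj₁ v)) = inj₁ (f _ v)
⊆pair f _ (inj₁ (inj₂ refl)) = inj₂ (here refl)
⊆pair f _ (inj₂ refl) = inj₂ (there (here refl))

expand-α : ∀ {N Γ : FSet ATM} {F G H} → Expansion F ((G ∷ H ∷ []) ∷ []) → N ≐ Γ ,, F →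
  Refuted (Γ ,, G ,, H) → Refuted N
expand-α e n d = expand (principal n) e λ { (here refl) → weaken (⊆pair (side n)) d }

expand-β : ∀ {N Γ : FSet ATM} {F G H} →
  Expansion F ((G ∷ []) ∷ (H ∷ []) ∷ []) → N ≐ Γ ,, F →
  Refuted (Γ ,, G) → Refuted (Γ ,, H) → Refuted N
expand-β e n d d′ = expand (principal n) e λ
  { (here refl) → weaken (⊆singleton (side n)) d
  ; (there (here refl)) → weaken (⊆singleton (side n)) d′ }

refute-rule : ∀ {N : FSet ATM} {Ns} → N ⇝ Ns → All Refuted Ns → Refuted N
refute-rule (∼∼ n) (d ∷ []) =
  expand (principal n) ∼∼ λ { (here refl) → weaken (⊆singleton (side n)) d }
refute-rule (∧⁺ n) (d ∷ []) = expand-α ∧⁺ n d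
refute-rule (∧⁻ n) (d ∷ e ∷ []) = expand-β ∧⁻ n d e
refute-rule (∨⁺ n) (d ∷ e ∷ []) = expand-β ∨⁺ n d e
refute-rule (∨⁻ n) (d ∷ []) = expand-α ∨⁻ n d
refute-rule (⊃⁺ n) (d ∷ e ∷ []) = expand-β ⊃⁺ n d e
refute-rule (⊃⁻ n) (d ∷ []) = expand-α ⊃⁻ n d
refute-rule {N = N} (|~⁺ {Γ} {A} {B} n) (d₁ ∷ d₂ ∷ d₃ ∷ []) = |~⁺ (principal n)
  (weaken (,,-mono (whole n)) d₁)
  (weaken (,,-mono (,,-mono sub)) d₂)
  (weaken (,,-mono (,,-mono (,,-mono (whole n)))) d₃)
  where
  sub : Γ ^↓ ,, A |~ B ⊆′ N ^↓
  sub _ (inj₁ v) = ↓-mono (side n) _ v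
  sub _ (inj₂ refl) = inj₁ (inj₁ (A , B , refl , principal n))
refute-rule (|~⁻ n) (d ∷ []) =
  |~⁻ (principal n) (weaken (,,-mono (,,-mono (,,-mono (|~±-mono (side n))))) d)
refute-rule (L⁻ n) (d ∷ []) = L⁻ (principal n) (weaken (,,-mono (L↓-mono (side n))) d)
refute-rule (L⁻₀ _) (d ∷ []) = L⁻₀ d

-- A branch may be closed at the root or further down; excluded middle decides
-- whether the root is an axiom, after which all branches are treated alike.
toRefuted : ExcludedMiddle (lsuc 0ℓ) → ∀ {N : FSet ATM} →
  (t : Tableau N) → Closed t → Refuted N
toRefuted-all : ExcludedMiddle (lsuc 0ℓ) → ∀ {Ns : List (FSet ATM)}
  (ts : All Tableau Ns) → (∀ {M} (i : M ∈ˡ Ns) → Closed (lookup ts i)) → All Refuted Ns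

toRefuted em {N} t c with em {Axiom N}
toRefuted em t c | yes (Γ , P , _ , q) = ax (q (inj₁ (inj₂ refl))) (q (inj₂ refl))
toRefuted em leaf c | no ¬ax with c end
... | here a with () ← ¬ax a
toRefuted em (node r ts) c | no ¬ax =
  refute-rule r (toRefuted-all em ts λ i b → tail (c (down i b)))
  where
  tail : ∀ {M} {i : M ∈ˡ _} {b : Branch (lookup ts i)} →
    ClosedBranch (down {r = r} {ts = ts} i b) → ClosedBranch b
  tail (here a) with () ← ¬ax a
  tail (there cb) = cb

toRefuted-all em [] cs = []
toRefuted-all em (t ∷ ts) cs =
  toRefuted em t (cs (here refl)) ∷ toRefuted-all em ts (λ i → cs (there i))

theorem5p2 : ExcludedMiddle (lsuc 0ℓ) →
    {ATM : Set} (Γ : FSet ATM) (A : PForm ATM) → Γ ⊆ 𝓛L′ →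
    HasClosedTableau (Γ ,, ∼ L A) →
    HasClosedTableau ((Γ ^|~±) ∪ (Γ ^□↓) ,, L A ,, □¬L A) →
    HasClosedTableau (Γ ,, □¬L A) →
    HasClosedTableau Γ
theorem5p2 em Γ A _ (t₁ , c₁) (t₂ , c₂) (t₃ , c₃) =
  fromRefuted em (weak-cut (toRefuted em t₁ c₁) (toRefuted em t₂ c₂) (toRefuted em t₃ c₃)) same
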